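{- Let $G$ be a finite group and suppose $G$ has a subgroup $H$ admitting a nontrivial homomorphism $\phi: H \to \{\pm 1\}$. Suppose further that there is a set $T$ of representatives of the left cosets of $H$ in $G$ such that $c^2 = 1$ for all $c \in T$. Then there is a function $f: G \to \{\pm 1\}$ with $\mathbb{E}_{x\in G} f(x) = 0$ and \[ \Pr_{x,y}\,[f(x)f(y) = f(xy)] \ge \frac{1}{2}\left(1 + \frac{|H|}{|G|}\right), \] where $x,y$ are chosen uniformly and independently from $G$.
   Context: $\mathbb{E}$ denotes the average over the uniform distribution on $G$. -}

module Defs where

open import Algebra.Bundles using (Group)
open import Algebra.Bundles.Raw using (RawGroup)
open import Algebra.Morphism.Structures using (module GroupMorphisms)
import Algebra.Morphism.GroupMonomorphism as GroupMonomorphism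
import Algebra.Properties.CommutativeMonoid.Sum as Sum
open import Data.Bool.Base using (if_then_else_)
open import Data.Fin.Base using (Fin)
open import Data.Fin.Properties using (*↔×; nonZeroIndex)
open import Data.Integer.Base using (+_)
open import Data.Nat.Base as ℕ using (ℕ; NonZero)
import Data.Nat.Properties as ℕₚ
open import Data.Product using (Σ; ∃; ∃!; _×_; _,_; proj₁; proj₂)
open import Data.Product.Function.NonDependent.Setoid using (_×-inverse_)
open import Data.Product.Relation.Binary.Pointwise.NonDependent
  using (×-setoid; Pointwise-≡↔≡)
open import Data.Rational.Base as ℚ using (ℚ; 1ℚ; _/_)
import Data.Rational.Properties as ℚₚ
open import Data.Sign.Base as Sign using (Sign)
import Data.Sign.Properties as Signₚ
open import Function.Base using (_∘_)
open import Function.Bundles using (Inverse)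
import Function.Construct.Composition as Composition
import Function.Construct.Symmetry as Symmetry
open import Level using (Level; _⊔_; suc)
open import Relation.Binary.Bundles using (Setoid)
open import Relation.Binary.Definitions using (_Respects_)
open import Relation.Binary.PropositionalEquality.Core using (_≡_)
import Relation.Binary.PropositionalEquality.Properties as ≡
open import Relation.Nullary.Decidable.Core using (does)
open import Relation.Unary using (Pred; Decidable; _∈_)

private
  variable
    a b c ℓ ℓ₁ ℓ₂ p t : Level

record Finite (S : Setoid c ℓ) : Set (c ⊔ ℓ) where
  field
    size        : ℕ
    enumeration : Inverse (≡.setoid (Fin size)) S

  element : Fin size → Setoid.Carrier S
  element = Inverse.to enumeration

open Finite

infixr 2 _×-finite_

_×-finite_ : {S : Setoid a ℓ₁} {T : Setoid b ℓ₂} →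
             Finite S → Finite T → Finite (×-setoid S T)
F ×-finite F′ = record
  { size        = size F ℕ.* size F′
  ; enumeration = Composition.inverse pairs (enumeration F ×-inverse enumeration F′)
  }
  where
  pairs : Inverse (≡.setoid (Fin (size F ℕ.* size F′)))
                  (×-setoid (≡.setoid (Fin (size F))) (≡.setoid (Fin (size F′))))
  pairs = Composition.inverse *↔× (Symmetry.inverse Pointwise-≡↔≡)

module _ {S : Setoid c ℓ} (F : Finite S) where

  open Setoid S using (Carrier)

  count : {P : Pred Carrier p} → Decidable P → ℕ
  count P? = Sum.sum ℕₚ.+-0-commutativeMonoid
    (λ i → if does (P? (element F i)) then 1 else 0)

  Pr : .{{_ : NonZero (size F)}} → {P : Pred Carrier p} → Decidable P → ℚ
  Pr P? = + count P? / size F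

  𝔼 : .{{_ : NonZero (size F)}} → (Carrier → ℚ) → ℚ
  𝔼 g = Sum.sum ℚₚ.+-0-commutativeMonoid (g ∘ element F) ℚ.* (+ 1 / size F)

-- The inverse in Data.Sign.Base.*-1-rawGroup is `opposite`, which is not
-- the inverse for _*_, so the raw group is taken from the lawful bundle.
±1-rawGroup : RawGroup _ _
±1-rawGroup = Group.rawGroup Signₚ.*-group

signToℚ : Sign → ℚ
signToℚ Sign.+ = 1ℚ
signToℚ Sign.- = ℚ.- 1ℚ

record FiniteGroup c ℓ : Set (suc (c ⊔ ℓ)) where
  field
    group : Group c ℓ

  open Group group public

  field
    finite : Finite setoid

  order : ℕ
  order = size finite

  instance
    order-nonZero : NonZero order
    order-nonZero = nonZeroIndex (Inverse.from (enumeration finite) ε)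

    order²-nonZero : NonZero (order ℕ.* order)
    order²-nonZero = ℕₚ.m*n≢0 order order

-- Membership is decidable, as it is classically for every subset;
-- this is what makes the number of members computable.
record Subgroup (G : FiniteGroup c ℓ) p : Set (c ⊔ ℓ ⊔ suc p) where
  open FiniteGroup G hiding (group; rawGroup)

  field
    Member    : Pred Carrier p
    member?   : Decidable Member
    resp      : Member Respects _≈_
    ε-closed  : ε ∈ Member
    ∙-closed  : ∀ {x y} → x ∈ Member → y ∈ Member → x ∙ y ∈ Member
    ⁻¹-closed : ∀ {x} → x ∈ Member → x ⁻¹ ∈ Member

  Element : Set (c ⊔ p)
  Element = Σ Carrier Member

  rawGroup : RawGroup (c ⊔ p) ℓ
  rawGroup = record
    { Carrier = Element
    ; _≈_     = λ (x , _) (y , _) → x ≈ y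
    ; _∙_     = λ (x , x∈H) (y , y∈H) → x ∙ y , ∙-closed x∈H y∈H
    ; ε       = ε , ε-closed
    ; _⁻¹     = λ (x , x∈H) → x ⁻¹ , ⁻¹-closed x∈H
    }

  group : Group (c ⊔ p) ℓ
  group = record
    { isGroup = GroupMonomorphism.isGroup inclusion isGroup }
    where
    open GroupMorphisms rawGroup (FiniteGroup.rawGroup G)
    inclusion : IsGroupMonomorphism proj₁
    inclusion = record
      { isGroupHomomorphism = record
        { isMonoidHomomorphism = record
          { isMagmaHomomorphism = record
            { isRelHomomorphism = record { cong = λ x≈y → x≈y }
            ; homo              = λ _ _ → Setoid.refl setoid
            }
          ; ε-homo = Setoid.refl setoid
          }
        ; ⁻¹-homo = λ _ → Setoid.refl setoid
        }
      ; injective = λ x≈y → x≈y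
      }

  cardinality : ℕ
  cardinality = count finite member?

  leftCoset : Carrier → Pred Carrier (c ⊔ ℓ ⊔ p)
  leftCoset x y = ∃ λ h → h ∈ Member × y ≈ x ∙ h

  IsSignHomomorphism : (Element → Sign) → Set (c ⊔ ℓ ⊔ p)
  IsSignHomomorphism = IsGroupHomomorphism
    where open GroupMorphisms rawGroup ±1-rawGroup

  -- T need not respect _≈_: `exactly one' is meant up to _≈_.
  IsLeftTransversal : Pred Carrier t → Set (c ⊔ ℓ ⊔ p ⊔ t)
  IsLeftTransversal T = ∀ x → ∃! _≈_ λ r → r ∈ T × r ∈ leftCoset x

{-# OPTIONS --safe #-}
module Submission where

-- Give every left coset of H an independent uniform sign σ and put F(x) = σ(xH) φ(x⁻¹r), where r is
-- the representative of xH; let f = F(ε) F, so that f(xh) = f(x) φ(h) for h in H and f(ε) = 1.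
-- Translating by an h with φ(h) = -1 negates f, so f is balanced.  Averaged over σ, the product
-- f(x) f(y) f(xy) survives only if the cosets of ε, x, y and xy agree in pairs:
--   * y ∈ H: the product is always 1, and such pairs contribute |G| |H| to the sum over x and y;
--   * x ∈ H and y⁻¹xy ∈ H: the product is φ(x) φ(y⁻¹xy), for fixed y a character of a subgroup,
--     so its sum over x is nonnegative;
--   * xy ∈ H and xH = yH = rH: the product is φ(r⁻¹x) φ(xr), and with x = rh and r² = 1 this is
--     φ(h) φ(r⁻¹hr), again a character.
-- Hence some σ makes the sum of f(x) f(y) f(xy) at least |G| |H|.

open import Defs
open import Algebra.Bundles using (CommutativeMonoid)
import Algebra.Properties.CommutativeMonoid.Sum as Sum
import Algebra.Properties.CommutativeSemigroup as CommutativeSemigroupProperties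
import Algebra.Properties.Group as GroupProperties
import Algebra.Properties.Semiring.Sum as SemiringSum
open import Algebra.Morphism.Structures using (module GroupMorphisms)
open import Data.Bool.Base using (if_then_else_)
open import Data.Fin.Base using (Fin; zero; suc; combine; remQuot; _↑ˡ_; _↑ʳ_)
open import Data.Fin.Properties using (remQuot-combine)
open import Data.Integer.Base as ℤ using (ℤ; +_; 0ℤ; 1ℤ; _◃_)
import Data.Integer.Properties as ℤₚ
open import Data.Integer.Tactic.RingSolver using (solve-∀)
open import Data.Nat.Base as ℕ using (ℕ; zero; suc; NonZero)
import Data.Nat.Properties as ℕₚ
open import Data.Product.Base using (∃; _×_; _,_; proj₁; proj₂)
open import Data.Rational.Base as ℚ using (ℚ; 0ℚ; 1ℚ; ½; _/_; _+_; _*_; _≥_)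
import Data.Rational.Properties as ℚₚ
import Data.Rational.Unnormalised.Base as ℚᵘ
import Data.Rational.Unnormalised.Properties as ℚᵘₚ
open import Data.Sign as Sign using (Sign)
import Data.Sign.Properties as Signₚ
open import Data.Vec.Base using (Vec; []; _∷_; lookup; updateAt)
open import Data.Vec.Properties using (lookup∘updateAt; lookup∘updateAt′)
open import Function.Base using (_∘_)
open import Function.Bundles using (Inverse)
import Function.Construct.Composition as Composition
import Function.Construct.Symmetry as Symmetry
open import Relation.Binary.Bundles using (Setoid)
open import Relation.Binary.Core using (_Preserves_⟶_)
open import Relation.Binary.PropositionalEquality
  using (_≡_; _≢_; refl; sym; trans; cong; cong₂; subst; subst₂; module ≡-Reasoning)
import Relation.Binary.PropositionalEquality.Properties as ≡
open import Relation.Nullary.Decidable.Core using (Dec; yes; no; does; decidable-stable)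
open import Relation.Nullary.Negation.Core using (¬_; contradiction)
open import Relation.Unary using (Pred; _∈_; _∉_; Decidable)

open Finite

-- Finite sums in commutative monoids and in the integers.

module _ {a ℓ} (M : CommutativeMonoid a ℓ) where
  open CommutativeMonoid M renaming (Carrier to A; _∙_ to _⊕_)
  open Sum M using (sum; sum-cong-≋; sum-permute)

  sum-↑ : ∀ m n (g : Fin (m ℕ.+ n) → A) →
          sum g ≈ sum (λ i → g (i ↑ˡ n)) ⊕ sum (λ j → g (m ↑ʳ j))
  sum-↑ zero    n g = CommutativeMonoid.sym M (identityˡ _)
  sum-↑ (suc m) n g =
    CommutativeMonoid.trans M (∙-congˡ (sum-↑ m n (g ∘ suc)))
                              (CommutativeMonoid.sym M (assoc _ _ _))

  sum-combine : ∀ m n (g : Fin (m ℕ.* n) → A) →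
                sum g ≈ sum (λ i → sum (λ j → g (combine {m} i j)))
  sum-combine zero    n g = CommutativeMonoid.refl M
  sum-combine (suc m) n g =
    CommutativeMonoid.trans M (sum-↑ n (m ℕ.* n) g)
      (∙-congˡ (sum-combine m n (λ k → g (n ↑ʳ k))))

  -- Conjugating `π` by the enumeration gives a permutation of `Fin (size F)`. Passing through the
  -- enumeration and back returns an element only up to equivalence, so `g` has to respect it.
  sum-reindex : ∀ {c ℓ′} {S : Setoid c ℓ′} (F : Finite S) (π : Inverse S S)
                (g : Setoid.Carrier S → A) → g Preserves Setoid._≈_ S ⟶ _≈_ →
                sum (g ∘ element F) ≈ sum (g ∘ Inverse.to π ∘ element F)
  sum-reindex {S = S} F π g g-cong = CommutativeMonoid.trans M
    (sum-permute (g ∘ element F) ρ)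
    (sum-cong-≋ {x = g ∘ element F ∘ Inverse.to ρ} {y = g ∘ Inverse.to π ∘ element F} λ i →
      g-cong (Inverse.strictlyInverseˡ (enumeration F) (Inverse.to π (element F i))))
    where
    ρ : Inverse (≡.setoid (Fin (size F))) (≡.setoid (Fin (size F)))
    ρ = Composition.inverse (enumeration F)
          (Composition.inverse π (Symmetry.inverse (enumeration F)))

open SemiringSum ℤₚ.+-*-semiring using (sum; sum-cong-≗; ∑-distrib-+; ∑-comm; *-distribˡ-sum)

module ℕSum = Sum ℕₚ.+-0-commutativeMonoid
module ℚSum = Sum ℚₚ.+-0-commutativeMonoid

sum-pos : ∀ {n} (g : Fin n → ℕ) → + ℕSum.sum g ≡ sum (λ i → + g i)
sum-pos {zero}  g = refl
sum-pos {suc n} g = trans (ℤₚ.pos-+ (g zero) _) (cong (ℤ._+_ (+ g zero)) (sum-pos (g ∘ suc)))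

sum-const : ∀ n i → sum {n} (λ _ → i) ≡ + n ℤ.* i
sum-const zero    i = sym (ℤₚ.*-zeroˡ i)
sum-const (suc n) i = trans (cong (ℤ._+_ i) (sum-const n i)) (sym (ℤₚ.suc-* (+ n) i))

sum-mono : ∀ {n} {g h : Fin n → ℤ} → (∀ i → g i ℤ.≤ h i) → sum g ℤ.≤ sum h
sum-mono {zero}  g≤h = ℤₚ.≤-refl
sum-mono {suc n} g≤h = ℤₚ.+-mono-≤ (g≤h zero) (sum-mono (g≤h ∘ suc))

sum-zero : ∀ {n} (g : Fin n → ℤ) → (∀ i → g i ≡ 0ℤ) → sum g ≡ 0ℤ
sum-zero {n} g g≡0 = trans (sum-cong-≗ g≡0) (trans (sum-const n 0ℤ) (ℤₚ.*-zeroʳ (+ n)))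

sum-nonNeg : ∀ {n} (g : Fin n → ℤ) → (∀ i → 0ℤ ℤ.≤ g i) → 0ℤ ℤ.≤ sum g
sum-nonNeg {n} g 0≤g =
  subst (ℤ._≤ sum g) (sum-zero {n} (λ _ → 0ℤ) (λ _ → refl)) (sum-mono 0≤g)

-- Signs and their values as integers.

i≡-i⇒i≡0 : ∀ {i} → i ≡ ℤ.- i → i ≡ 0ℤ
i≡-i⇒i≡0 {+ zero} _ = refl

opposite-◃ : ∀ s → Sign.opposite s ◃ 1 ≡ ℤ.- (s ◃ 1)
opposite-◃ Sign.+ = refl
opposite-◃ Sign.- = refl

*-◃ : ∀ s t → (s Sign.* t) ◃ 1 ≡ (s ◃ 1) ℤ.* (t ◃ 1)
*-◃ Sign.+ Sign.+ = refl
*-◃ Sign.+ Sign.- = refl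
*-◃ Sign.- Sign.+ = refl
*-◃ Sign.- Sign.- = refl

s*t*[t*u]≡s*u : ∀ s t u → s Sign.* t Sign.* (t Sign.* u) ≡ s Sign.* u
s*t*[t*u]≡s*u s t u = begin
  s Sign.* t Sign.* (t Sign.* u)  ≡⟨ Signₚ.*-assoc s t _ ⟩
  s Sign.* (t Sign.* (t Sign.* u)) ≡⟨ cong (s Sign.*_) (Signₚ.*-assoc t t u) ⟨
  s Sign.* (t Sign.* t Sign.* u)  ≡⟨ cong (λ v → s Sign.* (v Sign.* u)) (Signₚ.s*s≡+ t) ⟩
  s Sign.* u                      ∎
  where open ≡-Reasoning

-- Sums over the discrete cube

-- An expectation over independent uniform signs, left unnormalised: all that matters later is
-- whether it vanishes or is nonnegative.
cubeSum : ∀ {n} → (Vec Sign n → ℤ) → ℤ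
cubeSum {zero}  h = h []
cubeSum {suc n} h = cubeSum (h ∘ (Sign.+ ∷_)) ℤ.+ cubeSum (h ∘ (Sign.- ∷_))

cubeSum-cong : ∀ {n} {g h : Vec Sign n → ℤ} → (∀ σ → g σ ≡ h σ) → cubeSum g ≡ cubeSum h
cubeSum-cong {zero}  g≗h = g≗h []
cubeSum-cong {suc n} g≗h =
  cong₂ ℤ._+_ (cubeSum-cong (λ σ → g≗h (Sign.+ ∷ σ))) (cubeSum-cong (λ σ → g≗h (Sign.- ∷ σ)))

cubeSum-zero : ∀ n → cubeSum {n} (λ _ → 0ℤ) ≡ 0ℤ
cubeSum-zero zero    = refl
cubeSum-zero (suc n) = cong₂ ℤ._+_ (cubeSum-zero n) (cubeSum-zero n)

cubeSum-+ : ∀ {n} (g h : Vec Sign n → ℤ) →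
            cubeSum (λ σ → g σ ℤ.+ h σ) ≡ cubeSum g ℤ.+ cubeSum h
cubeSum-+ {zero}  g h = refl
cubeSum-+ {suc n} g h = trans
  (cong₂ ℤ._+_ (cubeSum-+ (g ∘ (Sign.+ ∷_)) (h ∘ (Sign.+ ∷_)))
               (cubeSum-+ (g ∘ (Sign.- ∷_)) (h ∘ (Sign.- ∷_))))
  (interchange (cubeSum (g ∘ (Sign.+ ∷_))) (cubeSum (h ∘ (Sign.+ ∷_)))
               (cubeSum (g ∘ (Sign.- ∷_))) (cubeSum (h ∘ (Sign.- ∷_))))
  where open CommutativeSemigroupProperties ℤₚ.+-commutativeSemigroup using (interchange)

cubeSum-neg : ∀ {n} (h : Vec Sign n → ℤ) → cubeSum (λ σ → ℤ.- h σ) ≡ ℤ.- cubeSum h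
cubeSum-neg {zero}  h = refl
cubeSum-neg {suc n} h = trans
  (cong₂ ℤ._+_ (cubeSum-neg (h ∘ (Sign.+ ∷_))) (cubeSum-neg (h ∘ (Sign.- ∷_))))
  (sym (ℤₚ.neg-distrib-+ (cubeSum (h ∘ (Sign.+ ∷_))) _))

cubeSum-sum : ∀ {n m} (h : Fin m → Vec Sign n → ℤ) →
              cubeSum (λ σ → sum (λ i → h i σ)) ≡ sum (λ i → cubeSum (h i))
cubeSum-sum {n} {zero}  h = cubeSum-zero n
cubeSum-sum {n} {suc m} h =
  trans (cubeSum-+ (h zero) _) (cong (ℤ._+_ (cubeSum (h zero))) (cubeSum-sum (h ∘ suc)))

flip : ∀ {n} → Fin n → Vec Sign n → Vec Sign n
flip i σ = updateAt σ i Sign.opposite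

cubeSum-flip : ∀ {n} i (h : Vec Sign n → ℤ) → cubeSum (h ∘ flip i) ≡ cubeSum h
cubeSum-flip zero    h = ℤₚ.+-comm (cubeSum (h ∘ (Sign.- ∷_))) _
cubeSum-flip (suc i) h =
  cong₂ ℤ._+_ (cubeSum-flip i (h ∘ (Sign.+ ∷_))) (cubeSum-flip i (h ∘ (Sign.- ∷_)))

-- Flipping one coordinate permutes the cube, so the sum equals its own negative.
cubeSum-odd : ∀ {n} i (h : Vec Sign n → ℤ) →
              (∀ σ → h (flip i σ) ≡ ℤ.- h σ) → cubeSum h ≡ 0ℤ
cubeSum-odd i h odd = i≡-i⇒i≡0
  (trans (sym (cubeSum-flip i h)) (trans (cubeSum-cong odd) (cubeSum-neg h)))

-- If the whole sum is nonnegative, so is the sum over one of the two half-cubes; descending into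
-- that half finds the point.
cubeSum-witness : ∀ {n} (h : Vec Sign n → ℤ) → 0ℤ ℤ.≤ cubeSum h → ∃ λ σ → 0ℤ ℤ.≤ h σ
cubeSum-witness {zero}  h 0≤h = [] , 0≤h
cubeSum-witness {suc n} h 0≤h
  with 0ℤ ℤₚ.≤? cubeSum (h ∘ (Sign.+ ∷_)) | 0ℤ ℤₚ.≤? cubeSum (h ∘ (Sign.- ∷_))
... | yes 0≤h₊ | _        = let σ , 0≤hσ = cubeSum-witness (h ∘ (Sign.+ ∷_)) 0≤h₊ in _ , 0≤hσ
... | no _     | yes 0≤h₋ = let σ , 0≤hσ = cubeSum-witness (h ∘ (Sign.- ∷_)) 0≤h₋ in _ , 0≤hσ
... | no 0≰h₊  | no 0≰h₋  =
  contradiction 0≤h (ℤₚ.<⇒≱ (ℤₚ.+-mono-< (ℤₚ.≰⇒> 0≰h₊) (ℤₚ.≰⇒> 0≰h₋)))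

-- Rational arithmetic and counting of pairs.

p+p≡0⇒p≡0 : ∀ p → p + p ≡ 0ℚ → p ≡ 0ℚ
p+p≡0⇒p≡0 p p+p≡0 = begin
  p              ≡⟨ ℚₚ.*-identityˡ p ⟨
  (½ + ½) * p    ≡⟨ ℚₚ.*-distribʳ-+ p ½ ½ ⟩
  ½ * p + ½ * p  ≡⟨ ℚₚ.*-distribˡ-+ ½ p p ⟨
  ½ * (p + p)    ≡⟨ cong (½ *_) p+p≡0 ⟩
  ½ * 0ℚ         ≡⟨ ℚₚ.*-zeroʳ ½ ⟩
  0ℚ             ∎
  where open ≡-Reasoning

signToℚ-opposite : ∀ s → signToℚ s + signToℚ (Sign.opposite s) ≡ 0ℚ
signToℚ-opposite Sign.+ = refl
signToℚ-opposite Sign.- = refl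

-- The shape in which ℚᵘ computes the inequality ½ (1 + h / n) ≤ k / n².
cross-multiplied : ∀ n h k →
  + n ℤ.* + n ℤ.+ + n ℤ.* + h ℤ.≤ + k ℤ.+ + k →
  1ℤ ℤ.* (1ℤ ℤ.* + n ℤ.+ + h ℤ.* 1ℤ) ℤ.* + (n ℕ.* n) ℤ.≤ + k ℤ.* + (2 ℕ.* (1 ℕ.* n))
cross-multiplied n h k n²+nh≤2k = begin
  1ℤ ℤ.* (1ℤ ℤ.* + n ℤ.+ + h ℤ.* 1ℤ) ℤ.* + (n ℕ.* n)
    ≡⟨ cong (ℤ._*_ (1ℤ ℤ.* (1ℤ ℤ.* + n ℤ.+ + h ℤ.* 1ℤ))) (ℤₚ.pos-* n n) ⟩
  1ℤ ℤ.* (1ℤ ℤ.* + n ℤ.+ + h ℤ.* 1ℤ) ℤ.* (+ n ℤ.* + n)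
    ≡⟨ factor-left (+ n) (+ h) ⟩
  + n ℤ.* (+ n ℤ.* + n ℤ.+ + n ℤ.* + h)
    ≤⟨ ℤₚ.*-monoˡ-≤-nonNeg (+ n) n²+nh≤2k ⟩
  + n ℤ.* (+ k ℤ.+ + k)
    ≡⟨ factor-right (+ n) (+ k) ⟩
  + k ℤ.* (+ 2 ℤ.* (1ℤ ℤ.* + n))
    ≡⟨ cong (λ i → + k ℤ.* (+ 2 ℤ.* i)) (ℤₚ.pos-* 1 n) ⟨
  + k ℤ.* (+ 2 ℤ.* + (1 ℕ.* n))
    ≡⟨ cong (ℤ._*_ (+ k)) (ℤₚ.pos-* 2 (1 ℕ.* n)) ⟨
  + k ℤ.* + (2 ℕ.* (1 ℕ.* n)) ∎
  where
  open ℤₚ.≤-Reasoning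
  factor-left : ∀ i j → 1ℤ ℤ.* (1ℤ ℤ.* i ℤ.+ j ℤ.* 1ℤ) ℤ.* (i ℤ.* i)
                        ≡ i ℤ.* (i ℤ.* i ℤ.+ i ℤ.* j)
  factor-left = solve-∀
  factor-right : ∀ i j → i ℤ.* (j ℤ.+ j) ≡ j ℤ.* (+ 2 ℤ.* (1ℤ ℤ.* i))
  factor-right = solve-∀

½*[1+h/n]≤k/n² : ∀ n h k .{{_ : NonZero n}} .{{_ : NonZero (n ℕ.* n)}} →
                 + n ℤ.* + n ℤ.+ + n ℤ.* + h ℤ.≤ + k ℤ.+ + k →
                 ½ * (1ℚ + + h / n) ℚ.≤ + k / (n ℕ.* n)
-- Matching on `suc` lets the unnormalised denominators compute, so that `cross-multiplied` has the
-- required type by definition.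
½*[1+h/n]≤k/n² n@(suc _) h k n²+nh≤2k = ℚₚ.toℚᵘ-cancel-≤ (begin
  ℚ.toℚᵘ (½ * (1ℚ + + h / n))                ≃⟨ ℚₚ.toℚᵘ-homo-* ½ (1ℚ + + h / n) ⟩
  ℚᵘ.½ ℚᵘ.* ℚ.toℚᵘ (1ℚ + + h / n)            ≃⟨ ℚᵘₚ.*-congˡ {ℚᵘ.½} (ℚₚ.toℚᵘ-homo-+ 1ℚ (+ h / n)) ⟩
  ℚᵘ.½ ℚᵘ.* (ℚᵘ.1ℚᵘ ℚᵘ.+ ℚ.toℚᵘ (+ h / n))   ≃⟨ ℚᵘₚ.*-congˡ {ℚᵘ.½} (ℚᵘₚ.+-congʳ ℚᵘ.1ℚᵘ (ℚₚ.toℚᵘ-fromℚᵘ (+ h ℚᵘ./ n))) ⟩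
  ℚᵘ.½ ℚᵘ.* (ℚᵘ.1ℚᵘ ℚᵘ.+ + h ℚᵘ./ n)         ≤⟨ ℚᵘ.*≤* (cross-multiplied n h k n²+nh≤2k) ⟩
  + k ℚᵘ./ (n ℕ.* n)                         ≃⟨ ℚₚ.toℚᵘ-fromℚᵘ (+ k ℚᵘ./ (n ℕ.* n)) ⟨
  ℚ.toℚᵘ (+ k / (n ℕ.* n))                   ∎)
  where open ℚᵘₚ.≤-Reasoning

count-× : ∀ {a b ℓ₁ ℓ₂ p} {S : Setoid a ℓ₁} {S′ : Setoid b ℓ₂} (F : Finite S) (F′ : Finite S′)
          {P : Pred (Setoid.Carrier S × Setoid.Carrier S′) p} (P? : Decidable P) →
          + count (F ×-finite F′) P? ≡
          sum (λ i → sum (λ j → + (if does (P? (element F i , element F′ j)) then 1 else 0)))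
count-× F F′ P? = begin
  + count (F ×-finite F′) P?
    ≡⟨ sum-pos (indicator ∘ remQuot (size F′)) ⟩
  sum (λ k → + indicator (remQuot (size F′) k))
    ≡⟨ sum-combine ℤₚ.+-0-commutativeMonoid (size F) (size F′) (λ k → + indicator (remQuot (size F′) k)) ⟩
  sum (λ i → sum (λ j → + indicator (remQuot (size F′) (combine {size F} i j))))
    ≡⟨ sum-cong-≗ (λ i → sum-cong-≗ (λ j → cong (λ ij → + indicator ij) (remQuot-combine {size F} i j))) ⟩
  sum (λ i → sum (λ j → + indicator (i , j))) ∎
  where
  open ≡-Reasoning
  indicator : Fin (size F) × Fin (size F′) → ℕ
  indicator (i , j) = if does (P? (element F i , element F′ j)) then 1 else 0

-- Doubled to stay in the integers. It converts the number of agreeing pairs into the sum of f(x)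
-- f(y) f(xy).
2·[s≡t]≡1+st : ∀ s t → let [s≡t] = + (if does (s Sign.≟ t) then 1 else 0) in
               [s≡t] ℤ.+ [s≡t] ≡ 1ℤ ℤ.+ (s Sign.* t ◃ 1)
2·[s≡t]≡1+st Sign.+ Sign.+ = refl
2·[s≡t]≡1+st Sign.+ Sign.- = refl
2·[s≡t]≡1+st Sign.- Sign.+ = refl
2·[s≡t]≡1+st Sign.- Sign.- = refl

-- Translations and division identities in the group.

module _ {c ℓ} (G : FiniteGroup c ℓ) where
  open FiniteGroup G renaming (refl to ≈-refl; sym to ≈-sym; trans to ≈-trans)
  open GroupProperties group
    using (\\-leftDividesˡ; \\-leftDividesʳ; //-rightDividesˡ; //-rightDividesʳ; ⁻¹-anti-homo-\\)

  leftTranslation : Carrier → Inverse setoid setoid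
  leftTranslation a = record
    { to        = a ∙_
    ; from      = a \\_
    ; to-cong   = ∙-congˡ
    ; from-cong = ∙-congˡ
    ; inverse   = (λ y≈ → ≈-trans (∙-congˡ y≈) (\\-leftDividesˡ a _))
                , (λ y≈ → ≈-trans (∙-congˡ y≈) (\\-leftDividesʳ a _))
    }

  rightTranslation : Carrier → Inverse setoid setoid
  rightTranslation a = record
    { to        = _∙ a
    ; from      = _// a
    ; to-cong   = ∙-congʳ
    ; from-cong = ∙-congʳ
    ; inverse   = (λ y≈ → ≈-trans (∙-congʳ y≈) (//-rightDividesˡ a _))
                , (λ y≈ → ≈-trans (∙-congʳ y≈) (//-rightDividesʳ a _))
    }

  ∙-\\-assoc : ∀ x y z → (x ∙ y) ∙ (y \\ z) ≈ x ∙ z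
  ∙-\\-assoc x y z = ≈-trans (assoc x y _) (∙-congˡ (\\-leftDividesˡ y z))

  \\-\\-telescope : ∀ x y z → (x \\ y) ∙ (y \\ z) ≈ x \\ z
  \\-\\-telescope x y z = ∙-\\-assoc (x ⁻¹) y z

  conj-∙ : ∀ y k x → (y \\ (k ∙ y)) ∙ (y \\ (x ∙ y)) ≈ y \\ ((k ∙ x) ∙ y)
  conj-∙ y k x = ≈-trans (assoc (y ⁻¹) (k ∙ y) _)
    (∙-congˡ (≈-trans (∙-\\-assoc k y (x ∙ y)) (≈-sym (assoc k x y))))

  x∙x≈ε⇒x⁻¹≈x : ∀ {x} → x ∙ x ≈ ε → x ⁻¹ ≈ x
  x∙x≈ε⇒x⁻¹≈x {x} x∙x≈ε = ≈-sym (GroupProperties.inverseˡ-unique group x x x∙x≈ε)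

  ∑ : (Carrier → ℤ) → ℤ
  ∑ g = sum (g ∘ element finite)

  module _ {p} (H : Subgroup G p) where
    open Subgroup H hiding (rawGroup; group)

    -- Twice the number of agreeing pairs is |G|² plus the sum of f(x) f(y) f(xy), hence at least
    -- |G|² + |G| |H|; dividing by 2|G|² gives the probability.
    Pr-bound : ∀ (f : Carrier → Sign) →
      + order ℤ.* + cardinality ℤ.≤ ∑ (λ x → ∑ (λ y → f x Sign.* f y Sign.* f (x ∙ y) ◃ 1)) →
      Pr (finite ×-finite finite) (λ (x , y) → f x Sign.* f y Sign.≟ f (x ∙ y))
        ≥ ½ * (1ℚ + + cardinality / order)
    Pr-bound f bound = ½*[1+h/n]≤k/n² order cardinality agreements (begin
      + order ℤ.* + order ℤ.+ + order ℤ.* + cardinality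
        ≤⟨ ℤₚ.+-monoʳ-≤ (+ order ℤ.* + order) bound ⟩
      + order ℤ.* + order ℤ.+ ∑ (λ x → ∑ (λ y → bias x y))
        ≡⟨ cong (ℤ._+ ∑ (λ x → ∑ (λ y → bias x y))) ∑∑1 ⟨
      ∑ (λ x → ∑ (λ y → 1ℤ)) ℤ.+ ∑ (λ x → ∑ (λ y → bias x y))
        ≡⟨ ∑∑-distrib-+ (λ _ _ → 1ℤ) bias ⟨
      ∑ (λ x → ∑ (λ y → 1ℤ ℤ.+ bias x y))
        ≡⟨ sum-cong-≗ (λ i → sum-cong-≗ (λ j → let x = element finite i; y = element finite j in
             2·[s≡t]≡1+st (f x Sign.* f y) (f (x ∙ y)))) ⟨
      ∑ (λ x → ∑ (λ y → agree x y ℤ.+ agree x y))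
        ≡⟨ ∑∑-distrib-+ agree agree ⟩
      ∑ (λ x → ∑ (λ y → agree x y)) ℤ.+ ∑ (λ x → ∑ (λ y → agree x y))
        ≡⟨ cong₂ ℤ._+_ agreements≡ agreements≡ ⟨
      + agreements ℤ.+ + agreements ∎)
      where
      open ℤₚ.≤-Reasoning
      agrees? : Decidable (λ (x , y) → f x Sign.* f y ≡ f (x ∙ y))
      agrees? (x , y) = f x Sign.* f y Sign.≟ f (x ∙ y)
      agreements : ℕ
      agreements = count (finite ×-finite finite) agrees?
      bias agree : Carrier → Carrier → ℤ
      bias x y = f x Sign.* f y Sign.* f (x ∙ y) ◃ 1
      agree x y = + (if does (agrees? (x , y)) then 1 else 0)
      agreements≡ : + agreements ≡ ∑ (λ x → ∑ (λ y → agree x y))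
      agreements≡ = count-× finite finite agrees?
      ∑∑1 : ∑ (λ x → ∑ (λ y → 1ℤ)) ≡ + order ℤ.* + order
      ∑∑1 = trans (sum-const order _) (cong (ℤ._*_ (+ order)) (trans (sum-const order 1ℤ) (ℤₚ.*-identityʳ (+ order))))
      ∑∑-distrib-+ : ∀ (g h : Carrier → Carrier → ℤ) →
        ∑ (λ x → ∑ (λ y → g x y ℤ.+ h x y)) ≡ ∑ (λ x → ∑ (g x)) ℤ.+ ∑ (λ x → ∑ (h x))
      ∑∑-distrib-+ g h = trans
        (sum-cong-≗ (λ i → ∑-distrib-+ (g (element finite i) ∘ element finite) _))
        (∑-distrib-+ (λ i → ∑ (g (element finite i))) _)

    -- Equality of left cosets of H.

    infix 4 _∼_

    _∼_ : Carrier → Carrier → Set p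
    x ∼ y = x \\ y ∈ Member

    ∼-refl : ∀ {x} → x ∼ x
    ∼-refl = resp (≈-sym (inverseˡ _)) ε-closed

    ∼-sym : ∀ {x y} → x ∼ y → y ∼ x
    ∼-sym x∼y = resp (⁻¹-anti-homo-\\ _ _) (⁻¹-closed x∼y)

    ∼-trans : ∀ {x y z} → x ∼ y → y ∼ z → x ∼ z
    ∼-trans x∼y y∼z = resp (\\-\\-telescope _ _ _) (∙-closed x∼y y∼z)

    ≈⇒∼ : ∀ {x y} → x ≈ y → x ∼ y
    ≈⇒∼ x≈y = resp (∙-congˡ x≈y) ∼-refl

    ∼-∙ : ∀ {x h} → h ∈ Member → x ∼ x ∙ h
    ∼-∙ = resp (≈-sym (\\-leftDividesʳ _ _))

    ∈⇒ε∼ : ∀ {x} → x ∈ Member → ε ∼ x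
    ∈⇒ε∼ x∈H = ∙-closed (⁻¹-closed ε-closed) x∈H

    ε∼⇒∈ : ∀ {x} → ε ∼ x → x ∈ Member
    ε∼⇒∈ ε∼x = resp (\\-leftDividesˡ _ _) (∙-closed ε-closed ε∼x)

    ∈-∼ : ∀ {x y} → x ∈ Member → x ∼ y → y ∈ Member
    ∈-∼ x∈H x∼y = resp (\\-leftDividesˡ _ _) (∙-closed x∈H x∼y)

    -- The homomorphism φ and the characters built from it.

    module _ (φ : Element → Sign) (φ-hom : IsSignHomomorphism φ) where
      open GroupMorphisms (Subgroup.rawGroup H) ±1-rawGroup using (module IsGroupHomomorphism)
      open IsGroupHomomorphism φ-hom using (⟦⟧-cong; ε-homo) renaming (homo to ∙-homo)

      -- Equality in H ignores membership proofs, so φ does not depend on them.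
      φ-resp : ∀ {x y} (x∈H : x ∈ Member) (y∈H : y ∈ Member) → x ≈ y → φ (x , x∈H) ≡ φ (y , y∈H)
      φ-resp _ _ x≈y = ⟦⟧-cong x≈y

      φ-∙ : ∀ {x y z} (x∈H : x ∈ Member) (y∈H : y ∈ Member) (z∈H : z ∈ Member) → x ∙ y ≈ z →
            φ (z , z∈H) ≡ φ (x , x∈H) Sign.* φ (y , y∈H)
      φ-∙ x∈H y∈H z∈H xy≈z = trans (⟦⟧-cong (≈-sym xy≈z)) (∙-homo (_ , x∈H) (_ , y∈H))

      -- The extension of φ by zero lets sums over subgroups be written as sums over all of G.
      φ̂ : Carrier → ℤ
      φ̂ x with member? x
      ... | yes x∈H = φ (x , x∈H) ◃ 1
      ... | no _    = 0ℤ

      φ̂-∈ : ∀ {x} (x∈H : x ∈ Member) → φ̂ x ≡ φ (x , x∈H) ◃ 1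
      φ̂-∈ {x} x∈H with member? x
      ... | yes x∈H′ = cong (_◃ 1) (φ-resp x∈H′ x∈H ≈-refl)
      ... | no x∉H   = contradiction x∈H x∉H

      φ̂-∉ : ∀ {x} → x ∉ Member → φ̂ x ≡ 0ℤ
      φ̂-∉ {x} x∉H with member? x
      ... | yes x∈H = contradiction x∈H x∉H
      ... | no _    = refl

      φ̂-cong : ∀ {x y} → x ≈ y → φ̂ x ≡ φ̂ y
      φ̂-cong {x} {y} x≈y with member? x
      ... | yes x∈H = trans (cong (_◃ 1) (φ-resp x∈H (resp x≈y x∈H) x≈y)) (sym (φ̂-∈ (resp x≈y x∈H)))
      ... | no x∉H  = sym (φ̂-∉ (x∉H ∘ resp (≈-sym x≈y)))

      -- Only `k` has to lie in H: if x is outside H then so is kx, and both sides vanish.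
      φ̂-∙ : ∀ {k} → k ∈ Member → ∀ x → φ̂ (k ∙ x) ≡ φ̂ k ℤ.* φ̂ x
      φ̂-∙ {k} k∈H x with member? x
      ... | yes x∈H = begin
        φ̂ (k ∙ x)                                ≡⟨ φ̂-∈ (∙-closed k∈H x∈H) ⟩
        φ (k ∙ x , ∙-closed k∈H x∈H) ◃ 1         ≡⟨ cong (_◃ 1) (∙-homo (k , k∈H) (x , x∈H)) ⟩
        (φ (k , k∈H) Sign.* φ (x , x∈H)) ◃ 1     ≡⟨ *-◃ (φ (k , k∈H)) (φ (x , x∈H)) ⟩
        (φ (k , k∈H) ◃ 1) ℤ.* (φ (x , x∈H) ◃ 1)  ≡⟨ cong (ℤ._* (φ (x , x∈H) ◃ 1)) (φ̂-∈ k∈H) ⟨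
        φ̂ k ℤ.* (φ (x , x∈H) ◃ 1)                ∎
        where open ≡-Reasoning
      ... | no x∉H = trans
        (φ̂-∉ (λ kx∈H → x∉H (resp (\\-leftDividesʳ k x) (∙-closed (⁻¹-closed k∈H) kx∈H))))
        (sym (ℤₚ.*-zeroʳ (φ̂ k)))

      -- On H ∩ yHy⁻¹ this is the character x ↦ φ(x) φ(y⁻¹xy); elsewhere it vanishes.
      ψ : Carrier → Carrier → ℤ
      ψ y x = φ̂ x ℤ.* φ̂ (y \\ (x ∙ y))

      ψ-cong : ∀ y {x x′} → x ≈ x′ → ψ y x ≡ ψ y x′
      ψ-cong y x≈x′ = cong₂ ℤ._*_ (φ̂-cong x≈x′) (φ̂-cong (∙-congˡ (∙-congʳ x≈x′)))

      -- A nonzero value at `k` forces both k and y⁻¹ky into H, so both factors are multiplicative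
      -- against an arbitrary x.
      ψ-∙ : ∀ y k → ψ y k ≢ 0ℤ → ∀ x → ψ y (k ∙ x) ≡ ψ y k ℤ.* ψ y x
      ψ-∙ y k ψk≢0 x = begin
        φ̂ (k ∙ x) ℤ.* φ̂ (y \\ ((k ∙ x) ∙ y))
          ≡⟨ cong (φ̂ (k ∙ x) ℤ.*_) (φ̂-cong (conj-∙ y k x)) ⟨
        φ̂ (k ∙ x) ℤ.* φ̂ ((y \\ (k ∙ y)) ∙ (y \\ (x ∙ y)))
          ≡⟨ cong₂ ℤ._*_ (φ̂-∙ k∈H x) (φ̂-∙ k′∈H (y \\ (x ∙ y))) ⟩
        φ̂ k ℤ.* φ̂ x ℤ.* (φ̂ (y \\ (k ∙ y)) ℤ.* φ̂ (y \\ (x ∙ y)))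
          ≡⟨ interchange (φ̂ k) (φ̂ x) _ _ ⟩
        ψ y k ℤ.* ψ y x ∎
        where
        k∈H : k ∈ Member
        k∈H = decidable-stable (member? k) λ k∉H →
          ψk≢0 (cong (ℤ._* φ̂ (y \\ (k ∙ y))) (φ̂-∉ k∉H))
        k′∈H : y \\ (k ∙ y) ∈ Member
        k′∈H = decidable-stable (member? (y \\ (k ∙ y))) λ k′∉H →
          ψk≢0 (trans (cong (φ̂ k ℤ.*_) (φ̂-∉ k′∉H)) (ℤₚ.*-zeroʳ (φ̂ k)))
        open ≡-Reasoning
        open CommutativeSemigroupProperties ℤₚ.*-commutativeSemigroup using (interchange)

      -- A negative sum S would satisfy S = ψ(k) S for each k with ψ(k) ≠ 0, so no ψ(k) could be negative.
      ∑ψ-nonNeg : ∀ y → 0ℤ ℤ.≤ ∑ (ψ y)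
      ∑ψ-nonNeg y = decidable-stable (0ℤ ℤₚ.≤? ∑ (ψ y)) λ 0≰∑ → 0≰∑
        (sum-nonNeg (ψ y ∘ element finite) λ i → decidable-stable (0ℤ ℤₚ.≤? _) λ 0≰ψ →
          ℤₚ.<⇒≱ (neg-fixed (ℤₚ.≰⇒> 0≰ψ) (ℤₚ.≰⇒> 0≰∑)) (ℤₚ.≤-reflexive (sym (translate _ (0≰ψ ∘ ℤₚ.≤-reflexive ∘ sym)))))
        where
        neg-fixed : ∀ {i j} → i ℤ.< 0ℤ → j ℤ.< 0ℤ → j ℤ.< i ℤ.* j
        neg-fixed {+ _}                     (ℤ.+<+ ()) _
        neg-fixed {ℤ.-[1+ _ ]} {+ _}        _ (ℤ.+<+ ())
        neg-fixed {ℤ.-[1+ _ ]} {ℤ.-[1+ _ ]} _ _ = ℤ.-<+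
        translate : ∀ k → ψ y k ≢ 0ℤ → ∑ (ψ y) ≡ ψ y k ℤ.* ∑ (ψ y)
        translate k ψk≢0 = begin
          ∑ (ψ y)                    ≡⟨ sum-reindex ℤₚ.+-0-commutativeMonoid finite (leftTranslation k) (ψ y) (ψ-cong y) ⟩
          ∑ (ψ y ∘ (k ∙_))           ≡⟨ sum-cong-≗ (λ i → ψ-∙ y k ψk≢0 (element finite i)) ⟩
          ∑ (λ x → ψ y k ℤ.* ψ y x)  ≡⟨ *-distribˡ-sum (ψ y k) (ψ y ∘ element finite) ⟨
          ψ y k ℤ.* ∑ (ψ y)          ∎
          where open ≡-Reasoning

      -- Functions satisfying f(xh) = f(x) φ(h) for h in H.

      Equivariant : (Carrier → Sign) → Set _
      Equivariant f = ∀ {x y} (x∼y : x ∼ y) → f y ≡ f x Sign.* φ (x \\ y , x∼y)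

      equivariant⇒cong : ∀ {f} → Equivariant f → f Preserves _≈_ ⟶ _≡_
      equivariant⇒cong {f} f-equiv {x} {y} x≈y = sym (begin
        f y                                ≡⟨ f-equiv (≈⇒∼ x≈y) ⟩
        f x Sign.* φ (x \\ y , ≈⇒∼ x≈y)    ≡⟨ cong (f x Sign.*_) (trans (⟦⟧-cong (≈-trans (∙-congˡ (≈-sym x≈y)) (inverseˡ x))) ε-homo) ⟩
        f x Sign.* Sign.+                  ≡⟨ Signₚ.*-identityʳ (f x) ⟩
        f x                                ∎)
        where open ≡-Reasoning

      equivariant⇒balanced : ∀ {f} → Equivariant f → ¬ (∀ h → φ h ≡ Sign.+) →
                             𝔼 finite (signToℚ ∘ f) ≡ 0ℚ
      equivariant⇒balanced {f} f-equiv φ≢+ =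
        trans (cong (_* (+ 1 / order)) total≡0) (ℚₚ.*-zeroˡ (+ 1 / order))
        where
        total : ℚ
        total = ℚSum.sum (signToℚ ∘ f ∘ element finite)
        vanishes : ∀ h → φ h ≡ Sign.- → total ≡ 0ℚ
        vanishes (h , h∈H) φh≡- = p+p≡0⇒p≡0 total (begin
          total + total
            ≡⟨ cong (total ℚ.+_) (sum-reindex ℚₚ.+-0-commutativeMonoid finite (rightTranslation h)
                 (signToℚ ∘ f) (cong signToℚ ∘ equivariant⇒cong f-equiv)) ⟩
          total + ℚSum.sum (λ i → signToℚ (f (element finite i ∙ h)))
            ≡⟨ ℚSum.∑-distrib-+ (signToℚ ∘ f ∘ element finite) _ ⟨
          ℚSum.sum (λ i → signToℚ (f (element finite i)) + signToℚ (f (element finite i ∙ h)))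
            ≡⟨ ℚSum.sum-cong-≗ (λ i → trans (cong (λ s → signToℚ (f (element finite i)) + signToℚ s) (negates (element finite i)))
                 (signToℚ-opposite (f (element finite i)))) ⟩
          ℚSum.sum {order} (λ _ → 0ℚ)
            ≡⟨ ℚSum.sum-replicate-zero order ⟩
          0ℚ ∎)
          where
          open ≡-Reasoning
          negates : ∀ x → f (x ∙ h) ≡ Sign.opposite (f x)
          negates x = begin
            f (x ∙ h)                                   ≡⟨ f-equiv (∼-∙ h∈H) ⟩
            f x Sign.* φ (x \\ (x ∙ h) , ∼-∙ h∈H)       ≡⟨ cong (f x Sign.*_) (trans (⟦⟧-cong (\\-leftDividesʳ x h)) φh≡-) ⟩
            f x Sign.* Sign.-                           ≡⟨ Signₚ.*-comm (f x) Sign.- ⟩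
            Sign.opposite (f x)                         ∎
        total≡0 : total ≡ 0ℚ
        -- Nontriviality of φ is a negated universal statement and supplies no h with φ(h) = -. The
        -- goal is a decidable equality, so it can be proved by contradiction: if the total is
        -- nonzero, no such h exists and φ is trivial.
        total≡0 = decidable-stable (total ℚₚ.≟ 0ℚ) λ total≢0 → φ≢+ λ h →
          decidable-stable (φ h Signₚ.≟ Sign.+) λ φh≢+ → total≢0 (vanishes h (≢+⇒≡- φh≢+))
          where
          ≢+⇒≡- : ∀ {s} → s ≢ Sign.+ → s ≡ Sign.-
          ≢+⇒≡- {Sign.+} s≢+ = contradiction refl s≢+
          ≢+⇒≡- {Sign.-} _   = refl

      equivariant⇒φ : ∀ {f} → Equivariant f → f ε ≡ Sign.+ → ∀ {x} (x∈H : x ∈ Member) → f x ≡ φ (x , x∈H)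
      equivariant⇒φ {f} f-equiv fε≡+ {x} x∈H = begin
        f x                                    ≡⟨ f-equiv (∈⇒ε∼ x∈H) ⟩
        f ε Sign.* φ (ε \\ x , ∈⇒ε∼ x∈H)       ≡⟨ cong (Sign._* φ (ε \\ x , ∈⇒ε∼ x∈H)) fε≡+ ⟩
        φ (ε \\ x , ∈⇒ε∼ x∈H)                  ≡⟨ φ-resp (∈⇒ε∼ x∈H) x∈H (≈-trans (≈-sym (identityˡ _)) (\\-leftDividesˡ ε x)) ⟩
        φ (x , x∈H)                            ∎
        where open ≡-Reasoning

      -- Coset representatives and the functions given by signs on cosets.

      module _ {t} {T : Pred Carrier t} (T-transversal : IsLeftTransversal T)
               (T-involutive : ∀ r → r ∈ T → r ∙ r ≈ ε) where

        rep : Carrier → Carrier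
        rep x = proj₁ (T-transversal x)

        rep∙rep≈ε : ∀ x → rep x ∙ rep x ≈ ε
        rep∙rep≈ε x = let _ , (r∈T , _) , _ = T-transversal x in T-involutive _ r∈T

        ∼-rep : ∀ x → x ∼ rep x
        ∼-rep x = let _ , (_ , _ , h∈H , r≈xh) , _ = T-transversal x in
          resp (∙-congˡ (≈-sym r≈xh)) (∼-∙ h∈H)

        -- The representative of yH also lies in xH, where the representative is unique.
        rep-cong : ∀ {x y} → x ∼ y → rep x ≈ rep y
        rep-cong {x} {y} x∼y =
          let _ , _ , unique = T-transversal x
              _ , (r∈T , _) , _ = T-transversal y
          in unique (r∈T , x \\ rep y , ∼-trans x∼y (∼-rep y) , ≈-sym (\\-leftDividesˡ x (rep y)))

        -- Labelling cosets by positions in the enumeration of G avoids enumerating the quotient.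
        index : Carrier → Fin order
        index x = Inverse.from (enumeration finite) (rep x)

        index-cong : ∀ {x y} → x ∼ y → index x ≡ index y
        index-cong x∼y = Inverse.from-cong (enumeration finite) (rep-cong x∼y)

        index-injective : ∀ {x y} → index x ≡ index y → x ∼ y
        index-injective {x} {y} eq = ∼-trans (∼-rep x) (∼-trans (≈⇒∼ rep≈rep) (∼-sym (∼-rep y)))
          where
          rep≈rep : rep x ≈ rep y
          rep≈rep = ≈-trans (≈-sym (Inverse.strictlyInverseˡ (enumeration finite) (rep x)))
            (≈-trans (Inverse.to-cong (enumeration finite) eq)
                     (Inverse.strictlyInverseˡ (enumeration finite) (rep y)))

        κ : Carrier → Sign
        κ x = φ (x \\ rep x , ∼-rep x)

        -- With r the common representative, x⁻¹r = (x⁻¹y)(y⁻¹r) gives κ(x) = φ(x⁻¹y) κ(y); a sign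
        -- is its own inverse, so the factor can change sides.
        κ-equivariant : Equivariant κ
        κ-equivariant {x} {y} x∼y = sym (begin
          κ x Sign.* s          ≡⟨ cong (Sign._* s) (φ-∙ x∼y (∼-rep y) (∼-rep x)
                                     (≈-trans (\\-\\-telescope x y (rep y)) (∙-congˡ (≈-sym (rep-cong x∼y))))) ⟩
          s Sign.* κ y Sign.* s ≡⟨ cong (Sign._* s) (Signₚ.*-comm s (κ y)) ⟩
          κ y Sign.* s Sign.* s ≡⟨ Signₚ.*-assoc (κ y) s s ⟩
          κ y Sign.* (s Sign.* s) ≡⟨ cong (κ y Sign.*_) (Signₚ.s*s≡+ s) ⟩
          κ y Sign.* Sign.+     ≡⟨ Signₚ.*-identityʳ (κ y) ⟩
          κ y                   ∎)
          where
          open ≡-Reasoning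
          s = φ (x \\ y , x∼y)

        -- The sign of a coset is stored at the index of its representative; other entries of σ are unused.
        F : Vec Sign order → Carrier → Sign
        F σ x = lookup σ (index x) Sign.* κ x

        F-equivariant : ∀ σ → Equivariant (F σ)
        F-equivariant σ x∼y = trans
          (cong₂ Sign._*_ (cong (lookup σ) (sym (index-cong x∼y))) (κ-equivariant x∼y))
          (sym (Signₚ.*-assoc (lookup σ _) (κ _) _))

        -- Unlike F σ, this takes the value + at ε, hence restricts to φ on H.
        f : Vec Sign order → Carrier → Sign
        f σ x = F σ ε Sign.* F σ x

        f-equivariant : ∀ σ → Equivariant (f σ)
        f-equivariant σ x∼y = trans (cong (F σ ε Sign.*_) (F-equivariant σ x∼y))
          (sym (Signₚ.*-assoc (F σ ε) (F σ _) _))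

        fε≡+ : ∀ σ → f σ ε ≡ Sign.+
        fε≡+ σ = Signₚ.s*s≡+ (F σ ε)

        f-φ : ∀ σ {x} (x∈H : x ∈ Member) → f σ x ≡ φ (x , x∈H)
        f-φ σ = equivariant⇒φ (f-equivariant σ) (fε≡+ σ)

        -- The effect of flipping the sign of one coset.

        _∼?_ : ∀ x y → Dec (x ∼ y)
        x ∼? y = member? (x \\ y)

        -- The factor by which flipping the sign of the coset of a changes F at x.
        δ : Carrier → Carrier → Sign
        δ a x = if does (a ∼? x) then Sign.- else Sign.+

        δ-∼ : ∀ {a x} → a ∼ x → δ a x ≡ Sign.-
        δ-∼ {a} {x} a∼x with a ∼? x
        ... | yes _  = refl
        ... | no a≁x = contradiction a∼x a≁x

        δ-≁ : ∀ {a x} → ¬ a ∼ x → δ a x ≡ Sign.+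
        δ-≁ {a} {x} a≁x with a ∼? x
        ... | yes a∼x = contradiction a∼x a≁x
        ... | no _    = refl

        -- Points of the coset of `a` share its index and read the flipped entry; by injectivity of
        -- `index` on cosets, all other points read an unchanged one.
        F-flip : ∀ a σ x → F (flip (index a) σ) x ≡ δ a x Sign.* F σ x
        F-flip a σ x with a ∼? x
        ... | yes a∼x = begin
          lookup (flip (index a) σ) (index x) Sign.* κ x
            ≡⟨ cong (λ i → lookup (flip i σ) (index x) Sign.* κ x) (index-cong a∼x) ⟩
          lookup (flip (index x) σ) (index x) Sign.* κ x
            ≡⟨ cong (Sign._* κ x) (lookup∘updateAt (index x) σ) ⟩
          Sign.- Sign.* lookup σ (index x) Sign.* κ x
            ≡⟨ Signₚ.*-assoc Sign.- (lookup σ (index x)) (κ x) ⟩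
          Sign.- Sign.* F σ x ∎
          where open ≡-Reasoning
        ... | no a≁x = cong (Sign._* κ x)
          (lookup∘updateAt′ (index x) (index a) (λ eq → a≁x (∼-sym (index-injective eq))) σ)

        open CommutativeSemigroupProperties Signₚ.*-commutativeSemigroup using (interchange)

        -- The extra factor `δ a ε` comes from the normalisation by `F σ ε`: the value changes
        -- exactly when the coset of `a` contains one of ε and x but not both.
        f-flip : ∀ a σ x → f (flip (index a) σ) x ≡ δ a ε Sign.* δ a x Sign.* f σ x
        f-flip a σ x = trans (cong₂ Sign._*_ (F-flip a σ ε) (F-flip a σ x))
          (interchange (δ a ε) (F σ ε) (δ a x) (F σ x))

        weight : Vec Sign order → Carrier → Carrier → Sign
        weight σ x y = f σ x Sign.* f σ y Sign.* f σ (x ∙ y)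

        -- Here `s`, `t` and `u` are the factors by which the flip changes f at x, y and xy. When
        -- their product is -, the weight is odd in that coordinate and cancels in the sum over the
        -- cube.
        weight-flip : ∀ a x y {s t u} →
          δ a ε Sign.* δ a x ≡ s → δ a ε Sign.* δ a y ≡ t → δ a ε Sign.* δ a (x ∙ y) ≡ u →
          s Sign.* t Sign.* u ≡ Sign.- →
          ∀ σ → weight (flip (index a) σ) x y ≡ Sign.opposite (weight σ x y)
        weight-flip a x y {s} {t} {u} δx≡s δy≡t δxy≡u stu≡- σ = begin
          weight (flip (index a) σ) x y
            ≡⟨ cong₂ Sign._*_ (cong₂ Sign._*_ (flips x δx≡s) (flips y δy≡t)) (flips (x ∙ y) δxy≡u) ⟩
          (s Sign.* f σ x) Sign.* (t Sign.* f σ y) Sign.* (u Sign.* f σ (x ∙ y))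
            ≡⟨ cong (Sign._* (u Sign.* f σ (x ∙ y))) (interchange s (f σ x) t (f σ y)) ⟩
          (s Sign.* t) Sign.* (f σ x Sign.* f σ y) Sign.* (u Sign.* f σ (x ∙ y))
            ≡⟨ interchange (s Sign.* t) (f σ x Sign.* f σ y) u (f σ (x ∙ y)) ⟩
          (s Sign.* t Sign.* u) Sign.* weight σ x y
            ≡⟨ cong (Sign._* weight σ x y) stu≡- ⟩
          Sign.opposite (weight σ x y) ∎
          where
          open ≡-Reasoning
          flips : ∀ z {v} → δ a ε Sign.* δ a z ≡ v → f (flip (index a) σ) z ≡ v Sign.* f σ z
          flips z eq = trans (f-flip a σ z) (cong (Sign._* f σ z) eq)

        -- The third surviving case: with r = `rep y`, this is φ(r⁻¹x) φ(xr) if x and y share a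
        -- coset and xy lies in H, and zero otherwise.
        ψ′ : Carrier → Carrier → ℤ
        ψ′ y x = φ̂ (rep y \\ x) ℤ.* φ̂ (x ∙ rep y)

        -- The average over σ of f σ x * f σ y * f σ (x ∙ y).
        average : ∀ {y} → Dec (y ∈ Member) → Carrier → ℤ
        average     (yes _) x = 1ℤ
        -- For y outside H the two supports are disjoint, since the first lies in H and the second
        -- in yH; at most one term is nonzero.
        average {y} (no _)  x = ψ y x ℤ.+ ψ′ y x

        -- Vanishing of `ψ` and `ψ′` off their supports.

        ψ-x∉H : ∀ {x y} → x ∉ Member → ψ y x ≡ 0ℤ
        ψ-x∉H x∉H = cong (ℤ._* φ̂ _) (φ̂-∉ x∉H)

        ψ-y≁xy : ∀ {x y} → ¬ y ∼ x ∙ y → ψ y x ≡ 0ℤ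
        ψ-y≁xy {x} y≁xy = trans (cong (φ̂ x ℤ.*_) (φ̂-∉ y≁xy)) (ℤₚ.*-zeroʳ (φ̂ x))

        ψ′-y≁x : ∀ {x y} → ¬ y ∼ x → ψ′ y x ≡ 0ℤ
        ψ′-y≁x {x} {y} y≁x = cong (ℤ._* φ̂ (x ∙ rep y)) (φ̂-∉ (y≁x ∘ ∼-trans (∼-rep y)))

        x∙rep∼x∙y : ∀ x y → x ∙ rep y ∼ x ∙ y
        x∙rep∼x∙y x y = resp (≈-trans (≈-sym (\\-leftDividesʳ (x ∙ rep y) _)) (∙-congˡ (∙-\\-assoc x (rep y) y)))
                             (∼-sym (∼-rep y))

        ψ′-xy∉H : ∀ {x y} → x ∙ y ∉ Member → ψ′ y x ≡ 0ℤ
        ψ′-xy∉H {x} {y} xy∉H = trans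
          (cong (φ̂ (rep y \\ x) ℤ.*_) (φ̂-∉ (λ xr∈H → xy∉H (∈-∼ xr∈H (x∙rep∼x∙y x y)))))
          (ℤₚ.*-zeroʳ (φ̂ (rep y \\ x)))

        -- Products that do not depend on σ.

        weight-y∈H : ∀ σ x {y} → y ∈ Member → weight σ x y ≡ Sign.+
        weight-y∈H σ x {y} y∈H = begin
          f σ x Sign.* f σ y Sign.* f σ (x ∙ y)
            -- Since f(xy) = f(x) φ(y) = f(x) f(y), the weight is a square.
            ≡⟨ cong (f σ x Sign.* f σ y Sign.*_) (trans (f-equivariant σ (∼-∙ y∈H))
                 (cong (f σ x Sign.*_) (trans (φ-resp (∼-∙ y∈H) y∈H (\\-leftDividesʳ x y)) (sym (f-φ σ y∈H))))) ⟩
          f σ x Sign.* f σ y Sign.* (f σ x Sign.* f σ y)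
            ≡⟨ Signₚ.s*s≡+ (f σ x Sign.* f σ y) ⟩
          Sign.+ ∎
          where open ≡-Reasoning

        -- Here f(x) = φ(x) and f(xy) = f(y) φ(y⁻¹xy), so f(y) occurs twice and cancels.
        weight-x∈H : ∀ σ {x y} → x ∈ Member → y ∼ x ∙ y → weight σ x y ◃ 1 ≡ ψ y x
        weight-x∈H σ {x} {y} x∈H y∼xy = begin
          weight σ x y ◃ 1
            ≡⟨ cong (_◃ 1) (cong₂ (λ s t → s Sign.* f σ y Sign.* t) (f-φ σ x∈H) (f-equivariant σ y∼xy)) ⟩
          s Sign.* f σ y Sign.* (f σ y Sign.* u) ◃ 1
            ≡⟨ cong (_◃ 1) (s*t*[t*u]≡s*u s (f σ y) u) ⟩
          s Sign.* u ◃ 1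
            ≡⟨ *-◃ s u ⟩
          (s ◃ 1) ℤ.* (u ◃ 1)
            ≡⟨ cong₂ ℤ._*_ (φ̂-∈ x∈H) (φ̂-∈ y∼xy) ⟨
          ψ y x ∎
          where
          open ≡-Reasoning
          s = φ (x , x∈H)
          u = φ (y \\ (x ∙ y) , y∼xy)

        -- With r = `rep y`, f(x) = f(r) φ(r⁻¹x), f(y) = f(r) φ(r⁻¹y) and f(xy) = φ(xr) φ(r⁻¹y).
        -- Both f(r) and φ(r⁻¹y) cancel in pairs.
        weight-xy∈H : ∀ σ {x y} → x ∙ y ∈ Member → y ∼ x → weight σ x y ◃ 1 ≡ ψ′ y x
        weight-xy∈H σ {x} {y} xy∈H y∼x = begin
          weight σ x y ◃ 1
            ≡⟨ cong (_◃ 1) (cong₂ Sign._*_ (cong₂ Sign._*_ (f-equivariant σ r∼x) (f-equivariant σ r∼y))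
                 (trans (f-φ σ xy∈H) (φ-∙ xr∈H r∼y xy∈H (∙-\\-assoc x (rep y) y)))) ⟩
          a Sign.* s Sign.* (a Sign.* u) Sign.* (v Sign.* u) ◃ 1
            ≡⟨ cong (_◃ 1) (cong₂ Sign._*_
                 (trans (cong (Sign._* (a Sign.* u)) (Signₚ.*-comm a s)) (s*t*[t*u]≡s*u s a u))
                 (Signₚ.*-comm v u)) ⟩
          s Sign.* u Sign.* (u Sign.* v) ◃ 1
            ≡⟨ cong (_◃ 1) (s*t*[t*u]≡s*u s u v) ⟩
          s Sign.* v ◃ 1
            ≡⟨ *-◃ s v ⟩
          (s ◃ 1) ℤ.* (v ◃ 1)
            ≡⟨ cong₂ ℤ._*_ (φ̂-∈ r∼x) (φ̂-∈ xr∈H) ⟨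
          ψ′ y x ∎
          where
          open ≡-Reasoning
          r∼y : rep y ∼ y
          r∼y = ∼-sym (∼-rep y)
          r∼x : rep y ∼ x
          r∼x = ∼-trans r∼y y∼x
          xr∈H : x ∙ rep y ∈ Member
          xr∈H = ∈-∼ xy∈H (∼-sym (x∙rep∼x∙y x y))
          a = f σ (rep y)
          s = φ (rep y \\ x , r∼x)
          u = φ (rep y \\ y , r∼y)
          v = φ (x ∙ rep y , xr∈H)

        -- Subtracting the average inside the cube sum makes the expected value zero, with no
        -- division by the size of the cube.
        deviation : ∀ {y} → Dec (y ∈ Member) → Carrier → Vec Sign order → ℤ
        deviation {y} y∈H? x σ = (weight σ x y ◃ 1) ℤ.- average y∈H? x

        -- Either the weight is constant in σ and equals the average, or some coset contains an odd
        -- number of ε, x, y, xy and flipping its sign negates the weight.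
        cubeSum-deviation : ∀ {y} (y∈H? : Dec (y ∈ Member)) x → cubeSum (deviation y∈H? x) ≡ 0ℤ
        cubeSum-deviation {y} y∈H? x = cases y∈H? (member? x)
          where
          constant : (y∈H? : Dec (y ∈ Member)) → (∀ σ → weight σ x y ◃ 1 ≡ average y∈H? x) →
                     cubeSum (deviation y∈H? x) ≡ 0ℤ
          constant y∈H? eq = trans
            (cubeSum-cong (λ σ → trans (cong (ℤ._- average y∈H? x) (eq σ)) (ℤₚ.+-inverseʳ (average y∈H? x))))
            (cubeSum-zero order)

          odd : (y∈H? : Dec (y ∈ Member)) → average y∈H? x ≡ 0ℤ → ∀ a →
                (∀ σ → weight (flip (index a) σ) x y ≡ Sign.opposite (weight σ x y)) →
                cubeSum (deviation y∈H? x) ≡ 0ℤ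
          odd y∈H? avg≡0 a flips = trans
            (cubeSum-cong (λ σ → trans (cong (λ i → (weight σ x y ◃ 1) ℤ.- i) avg≡0) (ℤₚ.+-identityʳ _)))
            (cubeSum-odd (index a) (λ σ → weight σ x y ◃ 1)
              (λ σ → trans (cong (_◃ 1) (flips σ)) (opposite-◃ (weight σ x y))))

          module _ (y∉H : y ∉ Member) where
            y≁ε : ¬ y ∼ ε
            y≁ε y∼ε = y∉H (ε∼⇒∈ (∼-sym y∼ε))

            case-x∈H : x ∈ Member → Dec (y ∼ x ∙ y) → cubeSum (deviation (no y∉H) x) ≡ 0ℤ
            case-x∈H x∈H y∼xy? = by y∼xy?
              where
              y≁x : ¬ y ∼ x
              y≁x y∼x = y≁ε (∼-trans y∼x (∼-sym (∈⇒ε∼ x∈H)))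
              by : Dec (y ∼ x ∙ y) → cubeSum (deviation (no y∉H) x) ≡ 0ℤ
              by (yes y∼xy) = constant (no y∉H) λ σ → trans (weight-x∈H σ x∈H y∼xy)
                (sym (trans (cong (ℤ._+_ (ψ y x)) (ψ′-y≁x y≁x)) (ℤₚ.+-identityʳ (ψ y x))))
              -- Among ε, x, y and xy, the coset of y contains y alone.
              by (no y≁xy) = odd (no y∉H) (cong₂ ℤ._+_ (ψ-y≁xy y≁xy) (ψ′-y≁x y≁x)) y
                (weight-flip y x y (cong₂ Sign._*_ (δ-≁ y≁ε) (δ-≁ y≁x)) (cong₂ Sign._*_ (δ-≁ y≁ε) (δ-∼ ∼-refl))
                  (cong₂ Sign._*_ (δ-≁ y≁ε) (δ-≁ y≁xy)) refl)

            case-x∉H : x ∉ Member → Dec (x ∙ y ∈ Member) → Dec (y ∼ x) → cubeSum (deviation (no y∉H) x) ≡ 0ℤ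
            case-x∉H x∉H (yes xy∈H) (yes y∼x) = constant (no y∉H) λ σ → trans (weight-xy∈H σ xy∈H y∼x)
              (sym (trans (cong (ℤ._+ ψ′ y x) (ψ-x∉H x∉H)) (ℤₚ.+-identityˡ (ψ′ y x))))
            -- Both ε and xy lie in H, and the coset of x contains x alone.
            case-x∉H x∉H (yes xy∈H) (no y≁x) = odd (no y∉H) (cong₂ ℤ._+_ (ψ-x∉H x∉H) (ψ′-y≁x y≁x)) x
              (weight-flip x x y (cong₂ Sign._*_ (δ-≁ x≁ε) (δ-∼ ∼-refl)) (cong₂ Sign._*_ (δ-≁ x≁ε) (δ-≁ (y≁x ∘ ∼-sym)))
                (cong₂ Sign._*_ (δ-≁ x≁ε) (δ-≁ (λ x∼xy → x≁ε (∼-trans x∼xy (∼-sym (∈⇒ε∼ xy∈H)))))) refl)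
              where
              x≁ε : ¬ x ∼ ε
              x≁ε x∼ε = x∉H (ε∼⇒∈ (∼-sym x∼ε))
            -- None of x, y, xy lies in H, so flipping the sign of H itself negates f at all three.
            case-x∉H x∉H (no xy∉H) _ = odd (no y∉H) (cong₂ ℤ._+_ (ψ-x∉H x∉H) (ψ′-xy∉H xy∉H)) ε
              (weight-flip ε x y (flipped x∉H) (flipped y∉H) (flipped xy∉H) refl)
              where
              flipped : ∀ {z} → z ∉ Member → δ ε ε Sign.* δ ε z ≡ Sign.-
              flipped z∉H = cong₂ Sign._*_ (δ-∼ ∼-refl) (δ-≁ (z∉H ∘ ε∼⇒∈))

          cases : (y∈H? : Dec (y ∈ Member)) → Dec (x ∈ Member) → cubeSum (deviation y∈H? x) ≡ 0ℤ
          cases (yes y∈H) _         = constant (yes y∈H) (λ σ → cong (_◃ 1) (weight-y∈H σ x y∈H))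
          cases (no y∉H)  (yes x∈H) = case-x∈H y∉H x∈H (y ∼? (x ∙ y))
          cases (no y∉H)  (no x∉H)  = case-x∉H y∉H x∉H (member? (x ∙ y)) (y ∼? x)

        -- Since rep y is an involution, substituting x ↦ rep y ∙ x turns ψ′ y into ψ (rep y).
        ∑ψ′-nonNeg : ∀ y → 0ℤ ℤ.≤ ∑ (ψ′ y)
        ∑ψ′-nonNeg y = subst (0ℤ ℤ.≤_) (sym ∑ψ′≡∑ψ) (∑ψ-nonNeg (rep y))
          where
          open ≡-Reasoning
          r = rep y
          ∑ψ′≡∑ψ : ∑ (ψ′ y) ≡ ∑ (ψ r)
          ∑ψ′≡∑ψ = begin
            ∑ (ψ′ y)
              ≡⟨ sum-reindex ℤₚ.+-0-commutativeMonoid finite (leftTranslation r) (ψ′ y)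
                   (λ x≈x′ → cong₂ ℤ._*_ (φ̂-cong (∙-congˡ x≈x′)) (φ̂-cong (∙-congʳ x≈x′))) ⟩
            ∑ (λ x → ψ′ y (r ∙ x))
              ≡⟨ sum-cong-≗ (λ i → cong₂ ℤ._*_ (φ̂-cong (\\-leftDividesʳ r (element finite i)))
                   (φ̂-cong (≈-trans (assoc r (element finite i) r) (∙-congʳ (≈-sym (x∙x≈ε⇒x⁻¹≈x (rep∙rep≈ε y))))))) ⟩
            ∑ (ψ r) ∎

        -- The lower bound on average and the choice of σ.

        ∑-average : ∀ {y} (y∈H? : Dec (y ∈ Member)) →
                    + order ℤ.* + (if does y∈H? then 1 else 0) ℤ.≤ ∑ (average y∈H?)
        ∑-average     (yes _) = ℤₚ.≤-reflexive (sym (sum-const order 1ℤ))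
        ∑-average {y} (no _)  = subst₂ ℤ._≤_ (sym (ℤₚ.*-zeroʳ (+ order)))
          (sym (∑-distrib-+ (ψ y ∘ element finite) (ψ′ y ∘ element finite)))
          (ℤₚ.+-mono-≤ (∑ψ-nonNeg y) (∑ψ′-nonNeg y))

        ∑∑-average : + order ℤ.* + cardinality ℤ.≤ ∑ (λ x → ∑ (λ y → average (member? y) x))
        ∑∑-average = begin
          + order ℤ.* + cardinality
            ≡⟨ cong (ℤ._*_ (+ order)) (sum-pos (indicator ∘ element finite)) ⟩
          + order ℤ.* ∑ (λ y → + indicator y)
            ≡⟨ *-distribˡ-sum (+ order) (λ i → + indicator (element finite i)) ⟩
          ∑ (λ y → + order ℤ.* + indicator y)
            ≤⟨ sum-mono (λ i → ∑-average (member? (element finite i))) ⟩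
          ∑ (λ y → ∑ (λ x → average (member? y) x))
            ≡⟨ ∑-comm (λ j i → average (member? (element finite j)) (element finite i)) ⟩
          ∑ (λ x → ∑ (λ y → average (member? y) x)) ∎
          where
          open ℤₚ.≤-Reasoning
          indicator : Carrier → ℕ
          indicator y = if does (member? y) then 1 else 0

        -- The total deviation sums to zero over the cube, so it is nonnegative at some σ; there the
        -- sum of weights is at least the sum of averages.
        ∑∑-weight : ∃ λ σ → + order ℤ.* + cardinality ℤ.≤ ∑ (λ x → ∑ (λ y → weight σ x y ◃ 1))
        ∑∑-weight = σ , (begin
          + order ℤ.* + cardinality
            ≤⟨ ∑∑-average ⟩
          ∑ (λ x → ∑ (λ y → average (member? y) x))
            ≡⟨ ℤₚ.+-identityˡ _ ⟨
          0ℤ ℤ.+ ∑ (λ x → ∑ (λ y → average (member? y) x))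
            ≤⟨ ℤₚ.+-monoˡ-≤ (∑ (λ x → ∑ (λ y → average (member? y) x))) 0≤total ⟩
          total σ ℤ.+ ∑ (λ x → ∑ (λ y → average (member? y) x))
            ≡⟨ ∑-distrib-+ _ (λ i → ∑ (λ y → average (member? y) (element finite i))) ⟨
          ∑ (λ x → ∑ (λ y → deviation (member? y) x σ) ℤ.+ ∑ (λ y → average (member? y) x))
            ≡⟨ sum-cong-≗ (λ i → trans
                 (sym (∑-distrib-+ _ (λ j → average (member? (element finite j)) (element finite i))))
                 (sum-cong-≗ (λ j → cancel (weight σ (element finite i) (element finite j) ◃ 1) _))) ⟩
          ∑ (λ x → ∑ (λ y → weight σ x y ◃ 1)) ∎)
          where
          open ℤₚ.≤-Reasoning
          total : Vec Sign order → ℤ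
          total σ = ∑ (λ x → ∑ (λ y → deviation (member? y) x σ))
          cubeSum-total : cubeSum total ≡ 0ℤ
          cubeSum-total = trans (cubeSum-sum (λ i σ → ∑ (λ y → deviation (member? y) (element finite i) σ)))
            (sum-zero _ λ i → trans
              (cubeSum-sum (λ j → deviation (member? (element finite j)) (element finite i)))
              (sum-zero _ λ j → cubeSum-deviation (member? (element finite j)) (element finite i)))
          witness : ∃ λ σ → 0ℤ ℤ.≤ total σ
          witness = cubeSum-witness total (ℤₚ.≤-reflexive (sym cubeSum-total))
          σ = proj₁ witness
          0≤total = proj₂ witness
          cancel : ∀ i j → i ℤ.- j ℤ.+ j ≡ i
          cancel = solve-∀

theorem4 :
    ∀ {c ℓ p t} (G : FiniteGroup c ℓ) (H : Subgroup G p) →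
    let open FiniteGroup G
        open Subgroup H
    in
    (φ : Element → Sign) → IsSignHomomorphism φ → ¬ (∀ h → φ h ≡ Sign.+) →
    (T : Pred Carrier t) → IsLeftTransversal T → (∀ r → r ∈ T → r ∙ r ≈ ε) →
    ∃ λ (f : Carrier → Sign) →
      f Preserves _≈_ ⟶ _≡_ ×
      𝔼 finite (signToℚ ∘ f) ≡ 0ℚ ×
      Pr (finite ×-finite finite) (λ (x , y) → f x Sign.* f y Sign.≟ f (x ∙ y))
        ≥ ½ * (1ℚ + + cardinality / order)
theorem4 G H φ φ-hom φ≢+ T T-transversal T-involutive =
  let σ , bound = ∑∑-weight G H φ φ-hom T-transversal T-involutive
      f-equiv = f-equivariant G H φ φ-hom T-transversal T-involutive σ
      fσ = f G H φ φ-hom T-transversal T-involutive σ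
  in fσ
   , equivariant⇒cong G H φ φ-hom f-equiv
   , equivariant⇒balanced G H φ φ-hom f-equiv φ≢+
   , Pr-bound G H fσ bound
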